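{- Let $k\geq 2$ be an integer and let $G$ be a simple graph of order $n\geq 11k$ with minimum degree $\delta(G)\geq k$. If $e(G)> \binom{n-k}{2}+k(k+1)$, then $G$ is Hamilton-connected unless $G$ is isomorphic to a subgraph of $S_{n}^{k}$ or of $T_{n}^{k}$.
   Context: All graphs are finite and simple; $e(G)$ is the number of edges of $G$. A graph is Hamilton-connected if every two distinct vertices are joined by a Hamilton path. $G+H$ denotes disjoint union, $G\vee H$ the join, $tK_1$ the edgeless graph on $t$ vertices. Define $S_{n}^{k}=K_{k}\vee (K_{n-(2k-1)}+(k-1)K_{1})$ and $T_{n}^{k}=K_{2}\vee (K_{n-(k+1)}+K_{k-1})$. -}

module Defs where

open import Data.Nat using (ℕ; zero; suc; _+_; _*_; _∸_; _≤_; _<_; _<ᵇ_)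
open import Data.Bool using (Bool; true; false; _∧_; _∨_; not; if_then_else_)
open import Data.Fin using (Fin; toℕ)
open import Data.Fin.Properties using (_≟_)
open import Data.List using (List; []; _∷_; length; filter; map; sum; allFin; concatMap)
open import Data.List.Relation.Unary.Unique.Propositional using (Unique)
open import Data.List.Membership.Propositional using (_∈_)
open import Data.Product using (Σ; _×_; ∃)
open import Relation.Nullary using (¬_; does)
open import Relation.Binary.PropositionalEquality using (_≡_; _≢_)
open import Function.Definitions using (Injective)

record Graph (n : ℕ) : Set where
  field
    adj    : Fin n → Fin n → Bool
    adj-sym    : ∀ u v → adj u v ≡ adj v u
    adj-irrefl : ∀ u → adj u u ≡ false
open Graph public

degree : ∀ {n} → Graph n → Fin n → ℕ
degree G u = length (filter (λ v → adj G u v ≡? true) (allFin _))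
  where
    open import Data.Bool.Properties using () renaming (_≟_ to _≡?_)

MinDegreeAtLeast : ∀ {n} → Graph n → ℕ → Set
MinDegreeAtLeast G k = ∀ u → k ≤ degree G u

edgeCount : ∀ {n} → Graph n → ℕ
edgeCount {n} G =
  length (concatMap (λ u → filter (λ v → Data.Bool.Properties._≟_ ((toℕ u <ᵇ toℕ v) ∧ adj G u v) true) (allFin n)) (allFin n))
  where import Data.Bool.Properties

data Walk {n : ℕ} (G : Graph n) : Fin n → Fin n → List (Fin n) → Set where
  stop : ∀ u → Walk G u u (u ∷ [])
  step : ∀ {u w v vs} → adj G u w ≡ true → Walk G w v vs → Walk G u v (u ∷ vs)

HamiltonPath : ∀ {n} → Graph n → Fin n → Fin n → Set
HamiltonPath {n} G u v =
  Σ (List (Fin n)) λ vs → Walk G u v vs × Unique vs × (∀ x → x ∈ vs)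

HamiltonConnected : ∀ {n} → Graph n → Set
HamiltonConnected {n} G = ∀ (u v : Fin n) → u ≢ v → HamiltonPath G u v

IsoToSubgraphOf : ∀ {n} → Graph n → Graph n → Set
IsoToSubgraphOf {n} G H =
  Σ (Fin n → Fin n) λ f → Injective _≡_ _≡_ f ×
    (∀ u v → adj G u v ≡ true → adj H (f u) (f v) ≡ true)

private
  neq : ∀ {n} → Fin n → Fin n → Bool
  neq u v = not (does (u ≟ v))

  open import Data.Bool.Properties using (not-involutive)
  open import Relation.Binary.PropositionalEquality using (refl; cong; sym; trans)
  open import Relation.Nullary using (yes; no)

  neq-sym : ∀ {n} (u v : Fin n) → neq u v ≡ neq v u
  neq-sym u v with u ≟ v | v ≟ u
  ... | yes _ | yes _ = refl
  ... | no _  | no _  = refl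
  ... | yes p | no q  = Data.Empty.⊥-elim (q (sym p)) where import Data.Empty
  ... | no p  | yes q = Data.Empty.⊥-elim (p (sym q)) where import Data.Empty

  neq-irr : ∀ {n} (u : Fin n) → neq u u ≡ false
  neq-irr u with u ≟ u
  ... | yes _ = refl
  ... | no p  = Data.Empty.⊥-elim (p refl) where import Data.Empty

  ∧-comm : ∀ a b → a ∧ b ≡ b ∧ a
  ∧-comm = Data.Bool.Properties.∧-comm where import Data.Bool.Properties
  ∨-comm : ∀ a b → a ∨ b ≡ b ∨ a
  ∨-comm = Data.Bool.Properties.∨-comm where import Data.Bool.Properties

  false-∧ : ∀ b → false ∧ b ≡ false
  false-∧ b = refl

-- S_n^k = K_k ∨ (K_{n-(2k-1)} + (k-1) K_1), on vertices 0..n-1: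
--   vertices 0..k-1           : the K_k, adjacent to everything;
--   vertices k..n-k           : the clique K_{n-(2k-1)};
--   vertices n-k+1..n-1       : the k-1 isolated vertices of the second part.
S-rel : ∀ (n k : ℕ) → Fin n → Fin n → Bool
S-rel n k u v =
  (toℕ u <ᵇ k) ∨ (toℕ v <ᵇ k) ∨ ((toℕ u <ᵇ suc (n ∸ k)) ∧ (toℕ v <ᵇ suc (n ∸ k)))

-- T_n^k = K_2 ∨ (K_{n-(k+1)} + K_{k-1}), on vertices 0..n-1:
--   vertices 0,1              : the K_2, adjacent to everything;
--   vertices 2..n-k           : the clique K_{n-(k+1)};
--   vertices n-k+1..n-1       : the clique K_{k-1}.
T-rel : ∀ (n k : ℕ) → Fin n → Fin n → Bool
T-rel n k u v =
  (toℕ u <ᵇ 2) ∨ (toℕ v <ᵇ 2) ∨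
  (((toℕ u <ᵇ suc (n ∸ k)) ∧ (toℕ v <ᵇ suc (n ∸ k))) ∨
   (not (toℕ u <ᵇ suc (n ∸ k)) ∧ not (toℕ v <ᵇ suc (n ∸ k))))

bool-symS : ∀ a b c d → a ∨ b ∨ (c ∧ d) ≡ b ∨ a ∨ (d ∧ c)
bool-symS true  true  c d = refl
bool-symS true  false c d = refl
bool-symS false true  c d = refl
bool-symS false false true  true  = refl
bool-symS false false true  false = refl
bool-symS false false false true  = refl
bool-symS false false false false = refl

bool-symT : ∀ a b c d → a ∨ b ∨ ((c ∧ d) ∨ (not c ∧ not d)) ≡ b ∨ a ∨ ((d ∧ c) ∨ (not d ∧ not c))
bool-symT true  true  c d = refl
bool-symT true  false c d = refl
bool-symT false true  c d = refl
bool-symT false false true  true  = refl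
bool-symT false false true  false = refl
bool-symT false false false true  = refl
bool-symT false false false false = refl

S-sym : ∀ n k (u v : Fin n) → S-rel n k u v ≡ S-rel n k v u
S-sym n k u v = bool-symS (toℕ u <ᵇ k) (toℕ v <ᵇ k) (toℕ u <ᵇ suc (n ∸ k)) (toℕ v <ᵇ suc (n ∸ k))

T-sym : ∀ n k (u v : Fin n) → T-rel n k u v ≡ T-rel n k v u
T-sym n k u v = bool-symT (toℕ u <ᵇ 2) (toℕ v <ᵇ 2) (toℕ u <ᵇ suc (n ∸ k)) (toℕ v <ᵇ suc (n ∸ k))

S : ∀ (n k : ℕ) → Graph n
S n k = record
  { adj = λ u v → neq u v ∧ S-rel n k u v
  ; adj-sym = λ u v → cong₂ _∧_ (neq-sym u v) (S-sym n k u v)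
  ; adj-irrefl = λ u → cong (_∧ S-rel n k u u) (neq-irr u)
  }
  where open import Relation.Binary.PropositionalEquality using (cong₂)

T : ∀ (n k : ℕ) → Graph n
T n k = record
  { adj = λ u v → neq u v ∧ T-rel n k u v
  ; adj-sym = λ u v → cong₂ _∧_ (neq-sym u v) (T-sym n k u v)
  ; adj-irrefl = λ u → cong (_∧ T-rel n k u u) (neq-irr u)
  }
  where open import Relation.Binary.PropositionalEquality using (cong₂)

{-# OPTIONS --safe #-}
module Submission where

-- Bondy–Chvátal: joining two nonadjacent vertices whose degree sum exceeds the order does not
-- affect Hamilton-connectedness, so G may be assumed closed. The vertices of degree > n/2 then
-- form a clique K, of size t say. Counting edges gives t > n/2, so that every vertex outside K
-- has a non-neighbour in K and hence degree at most n - t + 1; counting again gives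
-- n - t < k, and δ ≥ k leaves either a complete graph or a set F of k - 1 vertices of degree k
-- which all have the same neighbourhood A in K. The cases |A| = 2 and |A| = k are the two extremal
-- graphs. Otherwise 3 ≤ |A| < k: for b in K \ A the subgraph on {b} ∪ A ∪ F closes up to
-- a complete graph, and in its Hamilton paths b can be expanded to all of K \ A.

open import Defs
open import Data.Bool using (Bool; _∧_; _∨_; false; not; true)
open import Data.Bool.Properties using (T-≡; ¬-not; ∧-comm; ∨-comm; ∨-zeroʳ) renaming (_≟_ to _≟ᵇ_)
open import Data.Empty using (⊥)
open import Data.Fin using (Fin; cast; toℕ)
open import Data.Fin.Properties using (_≟_; any?; toℕ-cast; toℕ-injective; toℕ<n)
open import Data.List
  using (List; []; _++_; _∷_; allFin; cartesianProduct; concatMap; filter; length; lookup; map; reverse)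
open import Data.List.Membership.DecPropositional using (_∈?_)
open import Data.List.Membership.Propositional using (_∈_; _∉_; find; lose)
open import Data.List.Membership.Propositional.Properties
  using (∈-++⁺ʳ; ∈-++⁺ˡ; ∈-++⁻; ∈-allFin; ∈-cartesianProduct⁺; ∈-filter⁻)
open import Data.List.Properties
  using (++-assoc; length-++; length-tabulate; map-++; unfold-reverse)
open import Data.List.Relation.Binary.Permutation.Propositional
  using (_↭_; module PermutationReasoning; ↭-prep; ↭-refl; ↭-reflexive; ↭-swap; ↭-sym; ↭-trans; ↭⇒↭ₛ)
open import Data.List.Relation.Binary.Permutation.Propositional.Properties
  using (++-comm; ++⁺; ++⁺ʳ; ++⁺ˡ; map⁺; shift; ↭-length; ↭-reverse; ∈-resp-↭)
import Data.List.Relation.Binary.Permutation.Setoid.Properties as PermutationSetoid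
open import Data.List.Relation.Unary.All as All using (All)
open import Data.List.Relation.Unary.AllPairs using ([]; _∷_)
open import Data.List.Relation.Unary.Any as Any using (here; index; there)
open import Data.List.Relation.Unary.Any.Properties using (lookup-index)
open import Data.List.Relation.Unary.Unique.Propositional using (Unique)
open import Data.List.Relation.Unary.Unique.Propositional.Properties
  using (Unique[x∷xs]⇒x∉xs; allFin⁺; filter⁺)
open import Data.Nat hiding (_≟_)
open import Data.Nat.Combinatorics using (_C_; nC1≡n; nCk+nC[k+1]≡[n+1]C[k+1])
open import Data.Nat.Induction using (<-wellFounded)
open import Data.Nat.ListAction using (sum)
open import Data.Nat.ListAction.Properties using (sum-++; sum-↭)
open import Data.Nat.Properties hiding (_≟_)
open import Data.Nat.Tactic.RingSolver using (solve-∀)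
open import Data.Product using (_,_; _×_; proj₁; proj₂; ∃)
open import Data.Sum using (_⊎_; inj₁; inj₂)
open import Function using (Equivalence; _∘_)
open import Induction.WellFounded using (Acc; acc)
open import Relation.Binary.Definitions using (tri<; tri>; tri≈)
open import Relation.Binary.PropositionalEquality
  using (_≡_; _≢_; cong; cong₂; refl; setoid; subst; sym; trans; ≢-sym)
open import Relation.Nullary using (contradiction; does; no; yes; ¬?; ¬_)
open import Relation.Nullary.Decidable using (_×-dec_; dec-false; dec-true)
open import Relation.Unary using (Decidable)
open import Relation.Unary.Properties using (∁?)

private variable
  X Y : Set
  z : X
  zs zs′ : List X
  p q : X → Bool
  n : ℕ
  G H : Graph n
  a b c u v x y : Fin n
  ps qs xs ys : List (Fin n)

-- Permutations, finite sums and counting over lists.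

private
  true≢false : true ≢ false
  true≢false ()

Unique-resp-↭ : zs ↭ zs′ → Unique zs → Unique zs′
Unique-resp-↭ {X} = PermutationSetoid.Unique-resp-↭ (setoid X) ∘ ↭⇒↭ₛ

filter-↭-∁ : {P : X → Set} (P? : Decidable P) (xs : List X) →
  xs ↭ filter P? xs ++ filter (∁? P?) xs
filter-↭-∁ P? [] = ↭-refl
filter-↭-∁ P? (x ∷ xs) with does (P? x)
... | true  = ↭-prep x (filter-↭-∁ P? xs)
... | false = ↭-trans (↭-prep x (filter-↭-∁ P? xs)) (↭-sym (shift x (filter P? xs) _))

∑ : (X → ℕ) → List X → ℕ
∑ f xs = sum (map f xs)

∑-++ : (f : X → ℕ) (xs ys : List X) → ∑ f (xs ++ ys) ≡ ∑ f xs + ∑ f ys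
∑-++ f xs ys = trans (cong sum (map-++ f xs ys)) (sum-++ (map f xs) (map f ys))

∑-↭ : (f : X → ℕ) → zs ↭ zs′ → ∑ f zs ≡ ∑ f zs′
∑-↭ f xs↭ys = sum-↭ (map⁺ f xs↭ys)

∑-cong : {f g : X → ℕ} → (∀ x → f x ≡ g x) → (xs : List X) → ∑ f xs ≡ ∑ g xs
∑-cong f≗g []       = refl
∑-cong f≗g (x ∷ xs) = cong₂ _+_ (f≗g x) (∑-cong f≗g xs)

∑-mono : {f g : X → ℕ} (xs : List X) → (∀ {x} → x ∈ xs → f x ≤ g x) → ∑ f xs ≤ ∑ g xs
∑-mono []       f≤g = z≤n
∑-mono (x ∷ xs) f≤g = +-mono-≤ (f≤g (here refl)) (∑-mono xs (f≤g ∘ there))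

∑-const : (c : ℕ) (xs : List X) → ∑ (λ _ → c) xs ≡ length xs * c
∑-const c []       = refl
∑-const c (x ∷ xs) = cong (c +_) (∑-const c xs)

∑-bound : {f : X → ℕ} (c : ℕ) (xs : List X) → (∀ {x} → x ∈ xs → f x ≤ c) →
  ∑ f xs ≤ length xs * c
∑-bound c xs f≤c = ≤-trans (∑-mono xs f≤c) (≤-reflexive (∑-const c xs))

∑-distrib-+ : (f g : X → ℕ) (xs : List X) → ∑ (λ x → f x + g x) xs ≡ ∑ f xs + ∑ g xs
∑-distrib-+ f g []       = refl
∑-distrib-+ f g (x ∷ xs) rewrite ∑-distrib-+ f g xs = interchange (f x) (g x) (∑ f xs) (∑ g xs)
  where
  interchange : ∀ a b c d → a + b + (c + d) ≡ a + c + (b + d)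
  interchange = solve-∀

∑-swap : (g : X → Y → ℕ) (xs : List X) (ys : List Y) →
  ∑ (λ x → ∑ (g x) ys) xs ≡ ∑ (λ y → ∑ (λ x → g x y) xs) ys
∑-swap g []       ys = sym (trans (∑-const 0 ys) (*-zeroʳ (length ys)))
∑-swap g (x ∷ xs) ys = trans (cong (∑ (g x) ys +_) (∑-swap g xs ys))
  (sym (∑-distrib-+ (g x) (λ y → ∑ (λ x → g x y) xs) ys))

𝟙 : Bool → ℕ
𝟙 true  = 1
𝟙 false = 0

𝟙≤1 : ∀ b → 𝟙 b ≤ 1
𝟙≤1 true  = s≤s z≤n
𝟙≤1 false = z≤n

# : (X → Bool) → List X → ℕ
# p = ∑ (𝟙 ∘ p)

#-≤-length : (p : X → Bool) (xs : List X) → # p xs ≤ length xs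
#-≤-length p xs = ≤-trans (∑-bound 1 xs (λ {x} _ → 𝟙≤1 (p x))) (≤-reflexive (*-identityʳ _))

#-miss : (xs : List X) → z ∈ xs → p z ≡ false → # p xs < length xs
#-miss {p = p} (x ∷ xs) (here refl) px rewrite px = s≤s (#-≤-length p xs)
#-miss {p = p} (y ∷ xs) (there x∈)  px = +-mono-≤-< (𝟙≤1 (p y)) (#-miss xs x∈ px)

#-all : (xs : List X) → (∀ {y} → y ∈ xs → p y ≡ true) → # p xs ≡ length xs
#-all []       all = refl
#-all (x ∷ xs) all rewrite all (here refl) = cong suc (#-all xs (all ∘ there))

#-none : (xs : List X) → (∀ {y} → y ∈ xs → p y ≡ false) → # p xs ≡ 0
#-none []       none = refl
#-none (x ∷ xs) none rewrite none (here refl) = #-none xs (none ∘ there)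

#-pos : (xs : List X) → z ∈ xs → p z ≡ true → 0 < # p xs
#-pos (x ∷ xs) (here refl) px rewrite px = s≤s z≤n
#-pos {p = p} (y ∷ xs) (there x∈) px = ≤-trans (#-pos xs x∈ px) (m≤n+m _ (𝟙 (p y)))

#-zero : (xs : List X) → # p xs ≡ 0 → z ∈ xs → p z ≡ false
#-zero xs eq x∈ = ¬-not λ px → <-irrefl (sym eq) (#-pos xs x∈ px)

-- The vertex `x` is the only possible failure of `p`, and uniqueness lets it occur at most once.
#-all-but : (x : X) {xs : List X} → Unique xs → (∀ {y} → y ∈ xs → y ≢ x → p y ≡ true) →
  length xs ≤ suc (# p xs)
#-all-but x [] all = z≤n
#-all-but {p = p} x {y ∷ xs} (y∉ ∷ uniq) all with p y in eq
... | true  = s≤s (#-all-but x uniq (all ∘ there))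
... | false = s≤s (≤-reflexive (sym (#-all xs λ {z} z∈ → all (there z∈) λ { refl →
        true≢false (trans (sym (all (here refl) (All.lookup y∉ z∈))) eq) })))

𝟙-mono : ∀ {b c} → (b ≡ true → c ≡ true) → 𝟙 b ≤ 𝟙 c
𝟙-mono {false} b⇒c = z≤n
𝟙-mono {true}  b⇒c rewrite b⇒c refl = ≤-refl

#-mono : (xs : List X) → (∀ x → p x ≡ true → q x ≡ true) → # p xs ≤ # q xs
#-mono xs p⇒q = ∑-mono xs (λ {x} _ → 𝟙-mono (p⇒q x))

#-mono-< : (xs : List X) → (∀ x → p x ≡ true → q x ≡ true) →
  z ∈ xs → p z ≡ false → q z ≡ true → # p xs < # q xs
#-mono-< (x ∷ xs) p⇒q (here refl) px qx rewrite px | qx = s≤s (#-mono xs p⇒q)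
#-mono-< (y ∷ xs) p⇒q (there x∈)  px qx =
  +-mono-≤-< (𝟙-mono (p⇒q y)) (#-mono-< xs p⇒q x∈ px qx)

length-filter-≟ : (p : X → Bool) (xs : List X) → length (filter (λ x → p x ≟ᵇ true) xs) ≡ # p xs
length-filter-≟ p [] = refl
length-filter-≟ p (x ∷ xs) with p x
... | true  = cong suc (length-filter-≟ p xs)
... | false = length-filter-≟ p xs

length-concatMap : (f : X → List Y) (xs : List X) → length (concatMap f xs) ≡ ∑ (length ∘ f) xs
length-concatMap f []       = refl
length-concatMap f (x ∷ xs) =
  trans (length-++ (f x)) (cong (length (f x) +_) (length-concatMap f xs))

-- Joining and reversing walks.

infixr 5 _++[_]ʷ_

_++[_]ʷ_ : Walk G a b ps → adj G b c ≡ true → Walk G c v qs → Walk G a v (ps ++ qs)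
stop _   ++[ e ]ʷ w′ = step e w′
step d w ++[ e ]ʷ w′ = step d (w ++[ e ]ʷ w′)

adj-flip : (G : Graph n) → adj G a b ≡ true → adj G b a ≡ true
adj-flip G e = trans (adj-sym G _ _) e

reverseʷ : Walk G a b ps → Walk G b a (reverse ps)
reverseʷ (stop u) = stop u
reverseʷ {G = G} (step {u} {vs = vs} e w) rewrite unfold-reverse u vs =
  reverseʷ w ++[ adj-flip G e ]ʷ stop u

start∈ : Walk G a b ps → a ∈ ps
start∈ (stop _)   = here refl
start∈ (step _ _) = here refl

-- The Bondy-Chvátal closure relative to a list of vertices.

infix 4 _⊑_

_⊑_ : Graph n → Graph n → Set
G ⊑ H = ∀ u v → adj G u v ≡ true → adj H u v ≡ true

degIn : Graph n → List (Fin n) → Fin n → ℕ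
degIn G xs u = # (adj G u) xs

-- Stated relative to a vertex list because the closure is taken twice: on the whole graph and on
-- the small set `b ∷ A ++ F`. For a repetition-free `xs`, being a permutation of `xs` says that
-- each vertex is visited exactly once.
HConnectedOn : Graph n → List (Fin n) → Set
HConnectedOn G xs = ∀ {u v} → u ∈ xs → v ∈ xs → u ≢ v → ∃ λ ps → Walk G u v ps × ps ↭ xs

-- The contrapositive of "every pair with degree sum at least `length xs + 1` is adjacent", the
-- threshold for Hamilton-connectedness. The pair ranges over all vertices, so no membership in `xs`
-- has to be carried along.
Closed : Graph n → List (Fin n) → Set
Closed G xs = ∀ {u v} → u ≢ v → adj G u v ≡ false → degIn G xs u + degIn G xs v ≤ length xs

data EdgeOf (a b u v : Fin n) : Set where
  along : u ≡ a → v ≡ b → EdgeOf a b u v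
  back  : u ≡ b → v ≡ a → EdgeOf a b u v

addEdge : (G : Graph n) (a b : Fin n) → a ≢ b → Graph n
addEdge G a b a≢b = record
  { adj        = λ u v → adj G u v ∨ (does (u ≟ a) ∧ does (v ≟ b)) ∨ (does (u ≟ b) ∧ does (v ≟ a))
  ; adj-sym    = λ u v → cong₂ _∨_ (adj-sym G u v)
      (trans (∨-comm (does (u ≟ a) ∧ does (v ≟ b)) _)
        (cong₂ _∨_ (∧-comm (does (u ≟ b)) _) (∧-comm (does (u ≟ a)) _)))
  ; adj-irrefl = irrefl
  }
  where
  irrefl : ∀ u → adj G u u ∨ (does (u ≟ a) ∧ does (u ≟ b)) ∨ (does (u ≟ b) ∧ does (u ≟ a)) ≡ false
  irrefl u rewrite adj-irrefl G u with u ≟ a | u ≟ b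
  ... | yes refl | yes refl = contradiction refl a≢b
  ... | yes _    | no _     = refl
  ... | no _     | yes _    = refl
  ... | no _     | no _     = refl

module _ {n} (G : Graph n) {a b : Fin n} (a≢b : a ≢ b) where

  private G⁺ = addEdge G a b a≢b

  addEdge-⊒ : G ⊑ G⁺
  addEdge-⊒ u v e rewrite e = refl

  addEdge-new : adj G⁺ a b ≡ true
  addEdge-new with adj G a b
  ... | true  = refl
  ... | false rewrite dec-true (a ≟ a) refl | dec-true (b ≟ b) refl = refl

  addEdge-inv : ∀ u v → adj G⁺ u v ≡ true → adj G u v ≡ true ⊎ EdgeOf a b u v
  addEdge-inv u v e with adj G u v | u ≟ a | v ≟ b | u ≟ b | v ≟ a
  ... | true  | _     | _     | _     | _     = inj₁ refl
  ... | false | yes p | yes q | _     | _     = inj₂ (along p q)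
  ... | false | yes _ | no _  | yes p | yes q = inj₂ (back p q)
  ... | false | no _  | _     | yes p | yes q = inj₂ (back p q)
  ... | false | yes _ | no _  | yes _ | no _  = contradiction (sym e) true≢false
  ... | false | yes _ | no _  | no _  | _     = contradiction (sym e) true≢false
  ... | false | no _  | _     | yes _ | no _  = contradiction (sym e) true≢false
  ... | false | no _  | _     | no _  | _     = contradiction (sym e) true≢false

  -- A walk missing an endpoint of the new edge does not use it.
  avoiding : ∀ {c} → c ≡ a ⊎ c ≡ b → c ∉ ps → Walk G⁺ x y ps → Walk G x y ps
  avoiding c≡ c∉ (stop _) = stop _
  avoiding c≡ c∉ (step {u} {w} e p) with addEdge-inv u w e | c≡
  ... | inj₁ e′                | _         = step e′ (avoiding c≡ (c∉ ∘ there) p)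
  ... | inj₂ (along refl refl) | inj₁ refl = contradiction (here refl) c∉
  ... | inj₂ (along refl refl) | inj₂ refl = contradiction (there (start∈ p)) c∉
  ... | inj₂ (back refl refl)  | inj₁ refl = contradiction (there (start∈ p)) c∉
  ... | inj₂ (back refl refl)  | inj₂ refl = contradiction (here refl) c∉

  record Broken (x y : Fin n) (ps : List (Fin n)) : Set where
    constructor broken
    field
      {from to}     : Fin n
      {front rear}  : List (Fin n)
      split         : ps ≡ front ++ rear
      ends          : EdgeOf a b from to
      frontWalk     : Walk G x from front
      rearWalk      : Walk G to y rear

  -- A walk without repetition uses the new edge at most once: the endpoint from which the edge is
  -- left does not recur, so the rest of the walk is covered by `avoiding`.
  breakWalk : Unique ps → Walk G⁺ x y ps → Walk G x y ps ⊎ Broken x y ps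
  breakWalk uniq (stop _) = inj₁ (stop _)
  breakWalk uniq@(_ ∷ uniq′) (step {u} {w} e p) with addEdge-inv u w e
  ... | inj₂ d@(along refl refl) =
    inj₂ (broken refl d (stop _) (avoiding (inj₁ refl) (Unique[x∷xs]⇒x∉xs uniq) p))
  ... | inj₂ d@(back refl refl) =
    inj₂ (broken refl d (stop _) (avoiding (inj₂ refl) (Unique[x∷xs]⇒x∉xs uniq) p))
  ... | inj₁ e′ with breakWalk uniq′ p
  ...   | inj₁ p′ = inj₁ (step e′ p′)
  ...   | inj₂ (broken refl d f r) = inj₂ (broken refl d (step e′ f) r)

record Crossing (G : Graph n) (P Q : Fin n → Bool) (x y : Fin n) (ps : List (Fin n)) : Set where
  constructor crossing
  field
    {before after} : Fin n
    {front rear}   : List (Fin n)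
    split          : ps ≡ front ++ rear
    frontWalk      : Walk G x before front
    rearWalk       : Walk G after y rear
    P-before       : P before ≡ true
    Q-after        : Q after ≡ true

-- Pigeonhole: without a crossing, `P` at a vertex excludes `Q` at its successor, so each of the
-- `length ps - 1` consecutive pairs contributes at most one. The first vertex for `Q` and the last
-- for `P` lie outside this pairing and give the two extra terms.
findCrossing : ∀ P Q → Walk G x y ps →
  Crossing G P Q x y ps ⊎ # P ps + # Q ps < 𝟙 (Q x) + 𝟙 (P y) + length ps
findCrossing P Q (stop u) = inj₂ (≤-reflexive (rearrange (𝟙 (P u)) (𝟙 (Q u))))
  where
  rearrange : ∀ p q → suc (p + 0 + (q + 0)) ≡ q + p + 1
  rearrange = solve-∀
findCrossing {y = y} P Q (step {u} {w} {vs = vs} e p) with findCrossing P Q p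
... | inj₁ (crossing refl f r pb qa) = inj₁ (crossing refl (step e f) r pb qa)
... | inj₂ few with P u in Pu | Q w in Qw
...   | true | true = inj₁ (crossing refl (stop u) p Pu Qw)
...   | true | false = inj₂ (begin-strict
  1 + # P vs + (𝟙 (Q u) + # Q vs)          ≡⟨ rearrange (# P vs) (# Q vs) (𝟙 (Q u)) ⟩
  𝟙 (Q u) + 1 + (# P vs + # Q vs)          <⟨ +-monoʳ-< (𝟙 (Q u) + 1) few ⟩
  𝟙 (Q u) + 1 + (0 + 𝟙 (P y) + length vs)  ≡⟨ rearrange′ (𝟙 (Q u)) (𝟙 (P y)) (length vs) ⟩
  𝟙 (Q u) + 𝟙 (P y) + suc (length vs)      ∎)
  where
  open ≤-Reasoning
  rearrange : ∀ p q r → 1 + p + (r + q) ≡ r + 1 + (p + q)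
  rearrange = solve-∀
  rearrange′ : ∀ r p l → r + 1 + (0 + p + l) ≡ r + p + suc l
  rearrange′ = solve-∀
...   | false | b = inj₂ (begin-strict
  0 + # P vs + (𝟙 (Q u) + # Q vs)            ≡⟨ rearrange (# P vs) (# Q vs) (𝟙 (Q u)) ⟩
  𝟙 (Q u) + (# P vs + # Q vs)                <⟨ +-monoʳ-< (𝟙 (Q u)) few ⟩
  𝟙 (Q u) + (𝟙 b + 𝟙 (P y) + length vs)      ≤⟨ +-monoʳ-≤ (𝟙 (Q u)) (+-monoˡ-≤ (length vs) (+-monoˡ-≤ (𝟙 (P y)) (𝟙≤1 b))) ⟩
  𝟙 (Q u) + (1 + 𝟙 (P y) + length vs)        ≡⟨ rearrange′ (𝟙 (Q u)) (𝟙 (P y)) (length vs) ⟩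
  𝟙 (Q u) + 𝟙 (P y) + suc (length vs)        ∎)
  where
  open ≤-Reasoning
  rearrange : ∀ p q r → 0 + p + (r + q) ≡ r + (p + q)
  rearrange = solve-∀
  rearrange′ : ∀ r p l → r + (1 + p + l) ≡ r + p + suc l
  rearrange′ = solve-∀

-- The Bondy–Chvátal exchange: a missing edge ab between two walks is replaced
-- by two edges aq, bq′ at a consecutive pair q, q′ of one of the walks.
reconnect : Walk G x a ps → Walk G b y qs →
  length (ps ++ qs) < degIn G (ps ++ qs) a + degIn G (ps ++ qs) b →
  ∃ λ rs → Walk G x y rs × rs ↭ ps ++ qs
reconnect {G = G} {a = a} {ps = ps} {b = b} {qs = qs} p q big
  with findCrossing (adj G a) (adj G b) p | findCrossing (adj G a) (adj G b) q
-- The new walk runs from `x` to q, jumps to `a`, goes back along the first walk to q′, jumps to `b`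
-- and continues to `y`. The next case is the mirror image, reversing the initial piece of the
-- second walk.
... | inj₁ (crossing {front = f} {r} refl pf pr aq bq′) | _ =
  f ++ reverse r ++ qs ,
  (pf ++[ adj-flip G aq ]ʷ reverseʷ pr ++[ adj-flip G bq′ ]ʷ q) ,
  ↭-trans (++⁺ˡ f (++⁺ʳ qs (↭-reverse r))) (↭-reflexive (sym (++-assoc f r qs)))
... | inj₂ _ | inj₁ (crossing {front = f} {r} refl qf qr aq bq′) =
  ps ++ reverse f ++ r ,
  (p ++[ aq ]ʷ reverseʷ qf ++[ bq′ ]ʷ qr) ,
  ++⁺ˡ ps (++⁺ʳ r (↭-reverse f))
-- Since `a` and `b` are not their own neighbours, one boundary term vanishes on each walk, and each
-- walk then carries at most as many neighbours of `a` and `b`, counted together, as it has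
-- vertices.
... | inj₂ few₁ | inj₂ few₂ = contradiction big (≤⇒≯ (begin
  # A (ps ++ qs) + # B (ps ++ qs)              ≡⟨ cong₂ _+_ (∑-++ _ ps qs) (∑-++ _ ps qs) ⟩
  # A ps + # A qs + (# B ps + # B qs)          ≡⟨ rearrange (# A ps) (# A qs) (# B ps) (# B qs) ⟩
  # A ps + # B ps + (# A qs + # B qs)          ≤⟨ +-mono-≤ (≤-pred (≤-trans few₁ front-bound)) (≤-pred (≤-trans few₂ rear-bound)) ⟩
  length ps + length qs                        ≡⟨ length-++ ps ⟨
  length (ps ++ qs)                            ∎))
  where
  open ≤-Reasoning
  A = adj G a
  B = adj G b
  rearrange : ∀ i j k l → i + j + (k + l) ≡ i + k + (j + l)
  rearrange = solve-∀
  front-bound : ∀ {c} → 𝟙 (B c) + 𝟙 (A a) + length ps ≤ suc (length ps)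
  front-bound rewrite adj-irrefl G a = +-monoˡ-≤ (length ps) (≤-trans (≤-reflexive (+-identityʳ _)) (𝟙≤1 _))
  rear-bound : ∀ {c} → 𝟙 (B b) + 𝟙 (A c) + length qs ≤ suc (length qs)
  rear-bound rewrite adj-irrefl G b = +-monoˡ-≤ (length qs) (𝟙≤1 _)

-- A Hamilton path using the new edge is cut there and repaired by `reconnect`. Degrees into the
-- path equal degrees into `xs`, as the two lists are permutations of each other.
addEdge-HConnected : ∀ {xs} (a≢b : a ≢ b) → Unique xs →
  length xs < degIn G xs a + degIn G xs b →
  HConnectedOn (addEdge G a b a≢b) xs → HConnectedOn G xs
addEdge-HConnected {a = a} {b} {G = G} {xs} a≢b uniq big hc u∈ v∈ u≢v with hc u∈ v∈ u≢v
... | ps , p , ps↭ with breakWalk G a≢b (Unique-resp-↭ (↭-sym ps↭) uniq) p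
...   | inj₁ p′ = ps , p′ , ps↭
...   | inj₂ (broken {front = f} {r} refl d pf pr) with reconnect pf pr (big′ d)
  where
  big′ : ∀ {c d} → EdgeOf a b c d → length (f ++ r) < degIn G (f ++ r) c + degIn G (f ++ r) d
  big′ (along refl refl) rewrite ↭-length ps↭ | ∑-↭ (𝟙 ∘ adj G a) ps↭ | ∑-↭ (𝟙 ∘ adj G b) ps↭ = big
  big′ (back refl refl)  rewrite ↭-length ps↭ | ∑-↭ (𝟙 ∘ adj G a) ps↭ | ∑-↭ (𝟙 ∘ adj G b) ps↭
    = ≤-trans big (≤-reflexive (+-comm (degIn G xs a) _))
...     | rs , p″ , rs↭ = rs , p″ , ↭-trans rs↭ ps↭

-- Termination measure for `closure`; it counts ordered pairs, the diagonal included.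
missing : Graph n → ℕ
missing G = # (λ (u , v) → not (adj G u v)) (cartesianProduct (allFin _) (allFin _))

missing-addEdge : (G : Graph n) (a≢b : a ≢ b) → adj G a b ≡ false →
  missing (addEdge G a b a≢b) < missing G
missing-addEdge {a = a} {b} G a≢b nonadj = #-mono-< _ mono
  (∈-cartesianProduct⁺ (∈-allFin a) (∈-allFin b))
  (cong not (addEdge-new G a≢b)) (cong not nonadj)
  where
  mono : ∀ e → not (adj (addEdge G a b a≢b) (proj₁ e) (proj₂ e)) ≡ true →
    not (adj G (proj₁ e) (proj₂ e)) ≡ true
  mono (u , v) e with adj G u v | addEdge-⊒ G a≢b u v
  ... | false | _ = refl
  ... | true  | h rewrite h refl = e

closure : (G : Graph n) {xs : List (Fin n)} → Unique xs →
  ∃ λ H → G ⊑ H × Closed H xs × (HConnectedOn H xs → HConnectedOn G xs)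
closure {n} G {xs} uniq = go G (<-wellFounded _)
  where
  go : ∀ G → Acc _<_ (missing G) →
    ∃ λ H → G ⊑ H × Closed H xs × (HConnectedOn H xs → HConnectedOn G xs)
  go G (acc rec) with any? (λ u → any? (λ v →
    ¬? (u ≟ v) ×-dec (adj G u v ≟ᵇ false) ×-dec (length xs <? degIn G xs u + degIn G xs v)))
  ... | no none = G , (λ _ _ e → e) ,
    (λ u≢v nonadj → ≮⇒≥ λ big → none (_ , _ , u≢v , nonadj , big)) , (λ hc → hc)
  ... | yes (u , v , u≢v , nonadj , big) with go (addEdge G u v u≢v) (rec (missing-addEdge G u≢v nonadj))
  ...   | H , sub , closed , hc = H , (λ x y e → sub x y (addEdge-⊒ G u≢v x y e)) , closed ,
    (λ h → addEdge-HConnected u≢v uniq big (hc h))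

-- Hamilton paths in cliques and expansion of a vertex.

Unique-++⁻ʳ : (zs : List X) → Unique (zs ++ zs′) → Unique zs′
Unique-++⁻ʳ []       uniq       = uniq
Unique-++⁻ʳ (z ∷ zs) (_ ∷ uniq) = Unique-++⁻ʳ zs uniq

Unique-++-≢ : {z z′ : X} (zs : List X) → Unique (zs ++ zs′) → z ∈ zs → z′ ∈ zs′ → z ≢ z′
Unique-++-≢ (z ∷ zs) (z≢ ∷ _)   (here refl) z′∈ = All.lookup z≢ (∈-++⁺ʳ zs z′∈)
Unique-++-≢ (z ∷ zs) (_ ∷ uniq) (there z∈)  z′∈ = Unique-++-≢ zs uniq z∈ z′∈

∈⇒↭ : z ∈ zs → ∃ λ zs′ → zs ↭ z ∷ zs′
∈⇒↭ (here refl) = _ , ↭-refl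
∈⇒↭ (there {x = x} z∈) with ∈⇒↭ z∈
... | zs′ , zs↭ = x ∷ zs′ , ↭-trans (↭-prep x zs↭) (↭-swap x _ ↭-refl)

Clique : Graph n → List (Fin n) → Set
Clique G xs = ∀ {x y} → x ∈ xs → y ∈ xs → x ≢ y → adj G x y ≡ true

cliqueWalk : Unique (u ∷ xs) → Clique G (u ∷ xs) → ∃ λ v → v ∈ u ∷ xs × Walk G u v (u ∷ xs)
cliqueWalk {xs = []}     uniq cl = _ , here refl , stop _
cliqueWalk {xs = x ∷ xs} ((u≢x All.∷ _) ∷ uniq) cl
  with cliqueWalk uniq (λ x∈ y∈ → cl (there x∈) (there y∈))
... | v , v∈ , p = v , there v∈ , step (cl (here refl) (there (here refl)) u≢x) p

-- `cliqueWalk` prescribes only its starting vertex. Starting it at `v`, through everything but `u`,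
-- then reversing it and prefixing `u`, prescribes both ends.
clique-HConnected : Unique xs → Clique G xs → HConnectedOn G xs
clique-HConnected {xs = xs} {G = G} uniq cl {u} {v} u∈ v∈ u≢v with ∈⇒↭ u∈
... | ys , xs↭ with ∈-resp-↭ xs↭ v∈
...   | here refl = contradiction refl u≢v
...   | there v∈′ with ∈⇒↭ v∈′
...     | zs , ys↭ with Unique-resp-↭ (↭-trans xs↭ (↭-prep u ys↭)) uniq | ↭-trans xs↭ (↭-prep u ys↭)
...       | uniq′@(u≢ ∷ uniq″) | xs↭′
  with cliqueWalk {G = G} uniq″ (λ x∈ y∈ → cl (∈-resp-↭ (↭-sym xs↭′) (there x∈)) (∈-resp-↭ (↭-sym xs↭′) (there y∈)))
...         | w , w∈ , p = u ∷ reverse (v ∷ zs) ,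
  step (cl u∈ (∈-resp-↭ (↭-sym xs↭′) (there w∈)) (All.lookup u≢ w∈)) (reverseʷ p) ,
  ↭-trans (↭-prep u (↭-reverse (v ∷ zs))) (↭-sym xs↭′)

-- Replaces the vertex b of a walk by a walk from b to c.
expand : Walk G u v ps → b ∈ ps → b ≢ v → Walk G b c (b ∷ qs) →
  (∀ {w} → w ∈ ps → adj G b w ≡ true → adj G c w ≡ true) →
  ∃ λ rs → Walk G u v rs × rs ↭ ps ++ qs
expand (stop _) (here refl) b≢v q next = contradiction refl b≢v
-- The vertex `b` is entered as before and left from `c`, so only its successor has to be adjacent
-- to `c`.
expand {qs = qs} (step {vs = vs} e p) (here refl) b≢v q next =
  _ , (q ++[ next (there (start∈ p)) e ]ʷ p) , ↭-prep _ (++-comm qs vs)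
expand (step e p) (there b∈) b≢v q next with expand p b∈ b≢v q (next ∘ there)
... | rs , r , rs↭ = _ , step e r , ↭-prep _ rs↭

-- Splittings into A, B, F and the case 3 ≤ |A| < k.

-- The shape of a closed graph that is not complete.
record Split {n} (G : Graph n) (k : ℕ) (A B F : List (Fin n)) : Set where
  field
    cover  : allFin n ↭ (A ++ B) ++ F
    clique : Clique G (A ++ B)
    full   : x ∈ A → v ∈ F → adj G x v ≡ true
    empty  : x ∈ B → v ∈ F → adj G x v ≡ false
    degF   : v ∈ F → degIn G (allFin n) v ≡ k
    sizeF  : suc (length F) ≡ k

  unique : Unique ((A ++ B) ++ F)
  unique = Unique-resp-↭ cover (allFin⁺ n)

  degree-split : v ∈ F → # (adj G v) A + # (adj G v) F ≡ k
  degree-split {v} v∈ = trans (sym (begin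
    degIn G (allFin n) v                               ≡⟨ ∑-↭ _ cover ⟩
    # (adj G v) ((A ++ B) ++ F)                        ≡⟨ ∑-++ _ (A ++ B) F ⟩
    # (adj G v) (A ++ B) + # (adj G v) F               ≡⟨ cong (_+ # (adj G v) F) (∑-++ _ A B) ⟩
    # (adj G v) A + # (adj G v) B + # (adj G v) F      ≡⟨ cong (λ i → # (adj G v) A + i + # (adj G v) F)
                                                            (#-none B λ x∈ → trans (adj-sym G v _) (empty x∈ v∈)) ⟩
    # (adj G v) A + 0 + # (adj G v) F                  ≡⟨ cong (_+ # (adj G v) F) (+-identityʳ _) ⟩
    # (adj G v) A + # (adj G v) F                      ∎)) (degF v∈)
    where open Relation.Binary.PropositionalEquality.≡-Reasoning

  regroup : B ↭ b ∷ ys → (A ++ B) ++ F ↭ (b ∷ A ++ F) ++ ys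
  regroup {b} {ys} B↭ = begin
    (A ++ B) ++ F           ↭⟨ ++⁺ʳ F (++⁺ˡ A B↭) ⟩
    (A ++ b ∷ ys) ++ F      ↭⟨ ++⁺ʳ F (shift b A ys) ⟩
    b ∷ (A ++ ys) ++ F      ≡⟨ cong (b ∷_) (++-assoc A ys F) ⟩
    b ∷ A ++ (ys ++ F)      ↭⟨ ↭-prep b (++⁺ˡ A (++-comm ys F)) ⟩
    b ∷ A ++ (F ++ ys)      ≡⟨ cong (b ∷_) (++-assoc A F ys) ⟨
    b ∷ (A ++ F) ++ ys      ∎
    where open PermutationReasoning

  unique-inner : B ↭ b ∷ ys → Unique (b ∷ A ++ F)
  unique-inner {b} {ys} B↭ =
    Unique-++⁻ʳ ys (Unique-resp-↭ (↭-trans (regroup B↭) (++-comm (b ∷ A ++ F) ys)) unique)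

  A≢B : x ∈ A → b ∈ B → x ≢ b
  A≢B = Unique-++-≢ A (Unique-++⁻ʳ F (Unique-resp-↭ (++-comm (A ++ B) F) unique))

  module _ (3≤a : 3 ≤ length A) (a<k : length A < k) where

    -- In b ∷ A ++ F the pairs within F have degree sum 2k > k + |A|; once F is
    -- complete, the degree sum of b and a vertex of F is at least 2|A| + k - 2.
    inner-HConnected : b ∈ B → HConnectedOn G (b ∷ A ++ F)
    inner-HConnected {b} b∈B with ∈⇒↭ b∈B
    ... | ys , B↭ with closure G (unique-inner B↭)
    ...   | H , G⊑H , closed , transfer = transfer (clique-HConnected (unique-inner B↭) cliqueX)
      where
      xs₀ = b ∷ A ++ F

      uniqueAF : Unique (A ++ F)
      uniqueAF = Unique-++⁻ʳ (b ∷ []) (unique-inner B↭)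

      degree-F : v ∈ F → k ≤ degIn H xs₀ v
      degree-F {v} v∈ = begin
        k                               ≡⟨ degree-split v∈ ⟨
        # (adj G v) A + # (adj G v) F   ≡⟨ ∑-++ _ A F ⟨
        degIn G (A ++ F) v              ≤⟨ #-mono (A ++ F) (G⊑H v) ⟩
        degIn H (A ++ F) v              ≤⟨ m≤n+m _ (𝟙 (adj H v b)) ⟩
        degIn H xs₀ v                   ∎
        where open ≤-Reasoning

      cliqueF : Clique H F
      cliqueF {u} {v} u∈ v∈ u≢v = ¬-not λ nonadj → <-irrefl refl (begin-strict
        k + k                                ≤⟨ +-mono-≤ (degree-F u∈) (degree-F v∈) ⟩
        degIn H xs₀ u + degIn H xs₀ v        ≤⟨ closed u≢v nonadj ⟩
        suc (length (A ++ F))                ≡⟨ cong suc (length-++ A) ⟩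
        suc (length A + length F)            ≡⟨ +-suc (length A) (length F) ⟨
        length A + suc (length F)            ≡⟨ cong (length A +_) sizeF ⟩
        length A + k                         <⟨ +-monoˡ-< k a<k ⟩
        k + k                                ∎)
        where open ≤-Reasoning

      cliqueAF : Clique H (A ++ F)
      cliqueAF x∈ y∈ x≢y with ∈-++⁻ A x∈ | ∈-++⁻ A y∈
      ... | inj₁ x∈A | inj₁ y∈A = G⊑H _ _ (clique (∈-++⁺ˡ x∈A) (∈-++⁺ˡ y∈A) x≢y)
      ... | inj₁ x∈A | inj₂ y∈F = G⊑H _ _ (full x∈A y∈F)
      ... | inj₂ x∈F | inj₁ y∈A = adj-flip H (G⊑H _ _ (full y∈A x∈F))
      ... | inj₂ x∈F | inj₂ y∈F = cliqueF x∈F y∈F x≢y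

      b-A : x ∈ A → adj H b x ≡ true
      b-A x∈A = adj-flip H (G⊑H _ _ (clique (∈-++⁺ˡ x∈A) (∈-++⁺ʳ A b∈B) (A≢B x∈A b∈B)))

      b-F : v ∈ F → adj H b v ≡ true
      b-F {v} v∈ = ¬-not λ nonadj → <-irrefl refl (begin-strict
        -- The degree bound exceeds the order `length A + k` of the inner set precisely because
        -- `length A` exceeds 2.
        2 + length A + length F                     <⟨ +-monoˡ-< (length F) (+-monoˡ-< (length A) 3≤a) ⟩
        length A + length A + length F              ≡⟨ +-assoc (length A) _ _ ⟩
        length A + (length A + length F)            ≡⟨ cong₂ _+_ (#-all A b-A) (length-++ A) ⟨
        # (adj H b) A + length (A ++ F)             ≤⟨ +-mono-≤ degree-b (#-all-but v uniqueAF
                                                         λ y∈ y≢v → cliqueAF (∈-++⁺ʳ A v∈) y∈ (≢-sym y≢v)) ⟩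
        degIn H xs₀ b + suc (degIn H (A ++ F) v)    ≤⟨ +-monoʳ-≤ (degIn H xs₀ b) (s≤s (m≤n+m _ (𝟙 (adj H v b)))) ⟩
        degIn H xs₀ b + suc (degIn H xs₀ v)         ≡⟨ +-suc (degIn H xs₀ b) _ ⟩
        suc (degIn H xs₀ b + degIn H xs₀ v)         ≤⟨ s≤s (closed (λ { refl → b∉AF (∈-++⁺ʳ A v∈) }) nonadj) ⟩
        2 + length (A ++ F)                         ≡⟨ cong (2 +_) (length-++ A) ⟩
        2 + length A + length F                     ∎)
        where
        open ≤-Reasoning
        b∉AF : b ∉ A ++ F
        b∉AF = Unique[x∷xs]⇒x∉xs (unique-inner B↭)
        degree-b : # (adj H b) A ≤ degIn H xs₀ b
        degree-b = ≤-trans (m≤m+n _ (# (adj H b) F))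
          (≤-trans (≤-reflexive (sym (∑-++ _ A F))) (m≤n+m _ (𝟙 (adj H b b))))

      cliqueX : Clique H xs₀
      cliqueX (here refl) (here refl) b≢b = contradiction refl b≢b
      cliqueX (here refl) (there y∈)  _   with ∈-++⁻ A y∈
      ... | inj₁ y∈A = b-A y∈A
      ... | inj₂ y∈F = b-F y∈F
      cliqueX (there x∈)  (here refl) _   with ∈-++⁻ A x∈
      ... | inj₁ x∈A = adj-flip H (b-A x∈A)
      ... | inj₂ x∈F = adj-flip H (b-F x∈F)
      cliqueX (there x∈)  (there y∈)  x≢y = cliqueAF x∈ y∈ x≢y

    private
      covered : ∀ x → x ∉ B → x ∈ A ++ F
      covered x x∉B with ∈-++⁻ (A ++ B) (∈-resp-↭ cover (∈-allFin x))
      ... | inj₂ x∈F = ∈-++⁺ʳ A x∈F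
      ... | inj₁ x∈AB with ∈-++⁻ A x∈AB
      ...   | inj₁ x∈A = ∈-++⁺ˡ x∈A
      ...   | inj₂ x∈B = contradiction x∈B x∉B

      cliqueB : B ↭ b ∷ ys → Clique G (b ∷ ys)
      cliqueB B↭ x∈ y∈ = clique (∈-++⁺ʳ A (∈-resp-↭ (↭-sym B↭) x∈)) (∈-++⁺ʳ A (∈-resp-↭ (↭-sym B↭) y∈))

      uniqueB : B ↭ b ∷ ys → Unique (b ∷ ys)
      uniqueB B↭ = Unique-resp-↭ B↭ (Unique-++⁻ʳ A (Unique-++⁻ʳ F (Unique-resp-↭ (++-comm (A ++ B) F) unique)))

      neighbour-A : b ∈ B → x ∈ b ∷ A ++ F → adj G b x ≡ true → x ∈ A
      neighbour-A b∈B (here refl) e = contradiction (trans (sym e) (adj-irrefl G _)) true≢false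
      neighbour-A b∈B (there w∈) e with ∈-++⁻ A w∈
      ... | inj₁ w∈A = w∈A
      ... | inj₂ w∈F = contradiction (trans (sym e) (empty b∈B w∈F)) true≢false

      -- In a Hamilton path of the inner set, `b` is expanded to a walk through all of `B`, ending
      -- at some `c`. The neighbours of `b` in the inner set lie in `A`, and `A` is completely
      -- joined to `B`, so `c` can take over the edge that left `b`.
      through : b ∈ B → u ∈ b ∷ A ++ F → v ∈ b ∷ A ++ F → u ≢ v → b ≢ v →
        ∃ λ ps → Walk G u v ps × ps ↭ allFin n
      through {b} b∈B u∈ v∈ u≢v b≢v with ∈⇒↭ b∈B | inner-HConnected b∈B u∈ v∈ u≢v
      ... | ys , B↭ | ps , p , ps↭ with cliqueWalk {G = G} (uniqueB B↭) (cliqueB B↭)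
      ...   | c , c∈ , q with expand p (∈-resp-↭ (↭-sym ps↭) (here refl)) b≢v q next
        where
        next : ∀ {w} → w ∈ ps → adj G b w ≡ true → adj G c w ≡ true
        next w∈ e with neighbour-A b∈B (∈-resp-↭ ps↭ w∈) e | ∈-resp-↭ (↭-sym B↭) c∈
        ... | w∈A | c∈B = clique (∈-++⁺ʳ A c∈B) (∈-++⁺ˡ w∈A) (≢-sym (A≢B w∈A c∈B))
      ...     | rs , r , rs↭ = rs , r ,
        ↭-trans rs↭ (↭-trans (++⁺ʳ ys ps↭) (↭-sym (↭-trans cover (regroup B↭))))

      -- With both ends in `B`, expansion is replaced by concatenation: an inner Hamilton path from
      -- `u` to `a` exhausts `A` and `F`, and a path in the clique `B` without `u` finishes at `v`.
      both : a ∈ A → u ∈ B → v ∈ B → u ≢ v → ∃ λ ps → Walk G u v ps × ps ↭ allFin n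
      both {a} {u} {v} a∈A u∈B v∈B u≢v with ∈⇒↭ u∈B
      ... | ys , B↭ with ∈-resp-↭ B↭ v∈B
      ...   | here refl = contradiction refl u≢v
      ...   | there v∈ys with ∈⇒↭ v∈ys
      ...     | zs , ys↭ with ↭-trans B↭ (↭-prep u ys↭)
      ...       | B↭′ with inner-HConnected u∈B (here refl) (there (∈-++⁺ˡ a∈A)) (≢-sym (A≢B a∈A u∈B))
                        | uniqueB B↭′
      ...         | ps , p , ps↭ | _ ∷ uniq
        with cliqueWalk {G = G} uniq (λ x∈ y∈ → cliqueB B↭′ (there x∈) (there y∈))
      ...           | c , c∈ , q with ∈-resp-↭ (↭-sym B↭′) (there c∈)
      ...             | c∈B = ps ++ reverse (v ∷ zs) ,
        (p ++[ clique (∈-++⁺ˡ a∈A) (∈-++⁺ʳ A c∈B) (A≢B a∈A c∈B) ]ʷ reverseʷ q) ,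
        ↭-trans (++⁺ ps↭ (↭-reverse (v ∷ zs))) (↭-sym (↭-trans cover (regroup B↭′)))

    middle-HConnected : a ∈ A → b ∈ B → HConnectedOn G (allFin n)
    middle-HConnected a∈A b∈B {u} {v} _ _ u≢v with _∈?_ _≟_ u B | _∈?_ _≟_ v B
    ... | yes u∈B | yes v∈B = both a∈A u∈B v∈B u≢v
    ... | yes u∈B | no v∉B  = through u∈B (here refl) (there (covered v v∉B)) u≢v u≢v
    ... | no u∉B  | no v∉B  =
      through b∈B (there (covered u u∉B)) (there (covered v v∉B)) u≢v λ { refl → v∉B b∈B }
    -- The last vertex of a walk cannot be expanded, so the path is built starting from `v` and
    -- reversed.
    ... | no u∉B  | yes v∈B
      with through v∈B (here refl) (there (covered u u∉B)) (≢-sym u≢v) (≢-sym u≢v)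
    ...   | ps , p , ps↭ = reverse ps , reverseʷ p , ↭-trans (↭-reverse ps) ps↭

-- Embedding a split graph into the extremal graphs.

index-++ : (zs : List X) (z∈ : z ∈ zs ++ zs′) →
  (∃ λ (z∈′ : z ∈ zs) → toℕ (index z∈) ≡ toℕ (index z∈′)) ⊎
  (∃ λ (z∈′ : z ∈ zs′) → toℕ (index z∈) ≡ length zs + toℕ (index z∈′))
index-++ []       z∈         = inj₂ (z∈ , refl)
index-++ (_ ∷ zs) (here eq)  = inj₁ (here eq , refl)
index-++ (_ ∷ zs) (there z∈) with index-++ zs z∈
... | inj₁ (z∈′ , eq) = inj₁ (there z∈′ , cong suc eq)
... | inj₂ (z∈′ , eq) = inj₂ (z∈′ , cong suc eq)

index-injective : {z z′ : X} (z∈ : z ∈ zs) (z′∈ : z′ ∈ zs) → index z∈ ≡ index z′∈ → z ≡ z′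
index-injective {zs = zs} z∈ z′∈ eq =
  trans (lookup-index z∈) (trans (cong (lookup zs) eq) (sym (lookup-index z′∈)))

<ᵇ-true : ∀ {i j} → i < j → (i <ᵇ j) ≡ true
<ᵇ-true i<j = Equivalence.to T-≡ (<⇒<ᵇ i<j)

<ᵇ-false : ∀ {i j} → j ≤ i → (i <ᵇ j) ≡ false
<ᵇ-false j≤i = ¬-not λ eq → ≤⇒≯ j≤i (<ᵇ⇒< _ _ (Equivalence.from T-≡ eq))

∨-introˡ : ∀ {b c} → b ≡ true → b ∨ c ≡ true
∨-introˡ refl = refl

∨-introʳ : ∀ b {c} → c ≡ true → b ∨ c ≡ true
∨-introʳ b refl = ∨-zeroʳ b

module Embedding {n k} (k≤n : k ≤ n) {G : Graph n} {A B F} (split : Split G k A B F) where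

  open Split split

  private
    position : (u : Fin n) → u ∈ (A ++ B) ++ F
    position u = ∈-resp-↭ cover (∈-allFin u)

    size : length ((A ++ B) ++ F) ≡ n
    size = trans (sym (↭-length cover)) (length-tabulate _)

    size-AB : length (A ++ B) ≡ suc (n ∸ k)
    size-AB = +-cancelʳ-≡ (length F) _ _ (begin
      length (A ++ B) + length F        ≡⟨ length-++ (A ++ B) ⟨
      length ((A ++ B) ++ F)            ≡⟨ size ⟩
      n                                 ≡⟨ m∸n+n≡m k≤n ⟨
      n ∸ k + k                         ≡⟨ cong (n ∸ k +_) sizeF ⟨
      n ∸ k + suc (length F)            ≡⟨ +-suc (n ∸ k) (length F) ⟩
      suc (n ∸ k) + length F            ∎)
      where open Relation.Binary.PropositionalEquality.≡-Reasoning

    -- Both extremal graphs number their parts in the order core, large clique, remaining `k - 1`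
    -- vertices. Hence the position of a vertex in `(A ++ B) ++ F` serves as its image for both.
    f : Fin n → Fin n
    f u = cast size (index (position u))

    f-injective : ∀ {u v} → f u ≡ f v → u ≡ v
    f-injective {u} {v} eq = index-injective (position u) (position v) (toℕ-injective
      (trans (sym (toℕ-cast size _)) (trans (cong toℕ eq) (toℕ-cast size _))))

    data Place (u : Fin n) : Set where
      inA : toℕ (f u) < length A → Place u
      inB : u ∈ B → toℕ (f u) < suc (n ∸ k) → Place u
      inF : u ∈ F → suc (n ∸ k) ≤ toℕ (f u) → Place u

    place : ∀ u → Place u
    place u with index-++ (A ++ B) (position u)
    ... | inj₂ (u∈F , eq) = inF u∈F (begin
      suc (n ∸ k)                              ≡⟨ size-AB ⟨
      length (A ++ B)                          ≤⟨ m≤m+n _ _ ⟩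
      length (A ++ B) + toℕ (index u∈F)        ≡⟨ eq ⟨
      toℕ (index (position u))                 ≡⟨ toℕ-cast size _ ⟨
      toℕ (f u)                                ∎)
      where open ≤-Reasoning
    ... | inj₁ (u∈AB , eq) with index-++ A u∈AB
    ...   | inj₁ (u∈A , eq′) = inA (begin-strict
      toℕ (f u)                                ≡⟨ toℕ-cast size _ ⟩
      toℕ (index (position u))                 ≡⟨ trans eq eq′ ⟩
      toℕ (index u∈A)                          <⟨ toℕ<n (index u∈A) ⟩
      length A                                 ∎)
      where open ≤-Reasoning
    ...   | inj₂ (u∈B , _) = inB u∈B (begin-strict
      toℕ (f u)                                ≡⟨ toℕ-cast size _ ⟩
      toℕ (index (position u))                 ≡⟨ eq ⟩
      toℕ (index u∈AB)                         <⟨ toℕ<n (index u∈AB) ⟩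
      length (A ++ B)                          ≡⟨ size-AB ⟩
      suc (n ∸ k)                              ∎)
      where open ≤-Reasoning

    distinct : ∀ {u v} → adj G u v ≡ true → not (does (f u ≟ f v)) ≡ true
    distinct {u} {v} e = cong not (dec-false (f u ≟ f v) λ eq → irrefl (f-injective eq) e)
      where
      irrefl : ∀ {u v} → u ≡ v → adj G u v ≢ true
      irrefl refl e = contradiction (trans (sym e) (adj-irrefl G _)) true≢false

    B≁F : u ∈ B → v ∈ F → adj G u v ≢ true
    B≁F u∈B v∈F e = contradiction (trans (sym e) (empty u∈B v∈F)) true≢false

  ⊆-S : length A ≡ k → IsoToSubgraphOf G (S n k)
  ⊆-S a≡k = f , f-injective , λ u v e → cong₂ _∧_ (distinct e) (related e (place u) (place v))
    where
    -- A vertex of `F` has degree `k`, and its neighbours in `A` already number `k`.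
    F≁F : u ∈ F → v ∈ F → adj G u v ≢ true
    F≁F {u} {v} u∈F v∈F e = contradiction (trans (sym e) (#-zero F none v∈F)) true≢false
      where
      none : # (adj G u) F ≡ 0
      none = +-cancelˡ-≡ (length A) _ _ (begin
        length A + # (adj G u) F            ≡⟨ cong (_+ # (adj G u) F) (#-all A λ x∈A → adj-flip G (full x∈A u∈F)) ⟨
        # (adj G u) A + # (adj G u) F       ≡⟨ degree-split u∈F ⟩
        k                                   ≡⟨ a≡k ⟨
        length A                            ≡⟨ +-identityʳ _ ⟨
        length A + 0                        ∎)
        where open Relation.Binary.PropositionalEquality.≡-Reasoning
    related : adj G u v ≡ true → Place u → Place v → S-rel n k (f u) (f v) ≡ true
    related {u} e (inA lt) _ = ∨-introˡ (<ᵇ-true {toℕ (f u)} (≤-trans lt (≤-reflexive a≡k)))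
    related {u} {v} e _ (inA lt) = ∨-introʳ (toℕ (f u) <ᵇ k) (∨-introˡ (<ᵇ-true {toℕ (f v)} (≤-trans lt (≤-reflexive a≡k))))
    related {u} {v} e (inB _ lt) (inB _ lt′) =
      ∨-introʳ (toℕ (f u) <ᵇ k) (∨-introʳ (toℕ (f v) <ᵇ k) (cong₂ _∧_ (<ᵇ-true lt) (<ᵇ-true lt′)))
    related e (inB u∈B _) (inF v∈F _) = contradiction e (B≁F u∈B v∈F)
    related e (inF u∈F _) (inB v∈B _) = contradiction (adj-flip G e) (B≁F v∈B u∈F)
    related e (inF u∈F _) (inF v∈F _) = contradiction e (F≁F u∈F v∈F)

  ⊆-T : length A ≡ 2 → IsoToSubgraphOf G (T n k)
  ⊆-T a≡2 = f , f-injective , λ u v e → cong₂ _∧_ (distinct e) (related e (place u) (place v))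
    where
    related : adj G u v ≡ true → Place u → Place v → T-rel n k (f u) (f v) ≡ true
    related {u} e (inA lt) _ = ∨-introˡ (<ᵇ-true {toℕ (f u)} (≤-trans lt (≤-reflexive a≡2)))
    related {u} {v} e _ (inA lt) = ∨-introʳ (toℕ (f u) <ᵇ 2) (∨-introˡ (<ᵇ-true {toℕ (f v)} (≤-trans lt (≤-reflexive a≡2))))
    related {u} {v} e (inB _ lt) (inB _ lt′) =
      ∨-introʳ (toℕ (f u) <ᵇ 2) (∨-introʳ (toℕ (f v) <ᵇ 2) (∨-introˡ (cong₂ _∧_ (<ᵇ-true lt) (<ᵇ-true lt′))))
    related e (inB u∈B _) (inF v∈F _) = contradiction e (B≁F u∈B v∈F)
    related e (inF u∈F _) (inB v∈B _) = contradiction (adj-flip G e) (B≁F v∈B u∈F)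
    related {u} {v} e (inF _ le) (inF _ le′) =
      ∨-introʳ (toℕ (f u) <ᵇ 2) (∨-introʳ (toℕ (f v) <ᵇ 2)
        (∨-introʳ ((toℕ (f u) <ᵇ suc (n ∸ k)) ∧ (toℕ (f v) <ᵇ suc (n ∸ k)))
          (cong₂ (λ b c → not b ∧ not c) (<ᵇ-false le) (<ᵇ-false le′))))

-- Degree sums and the arithmetic of the edge counts.

degree-degIn : (G : Graph n) (u : Fin n) → degree G u ≡ degIn G (allFin n) u
degree-degIn G u = length-filter-≟ (adj G u) (allFin _)

-- `edgeCount` charges each edge to its smaller end. Swapping the summations charges a second copy
-- to the larger end, and together the two give all degrees.
handshake : (G : Graph n) → edgeCount G + edgeCount G ≡ ∑ (degIn G (allFin n)) (allFin n)
handshake {n} G = begin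
  edgeCount G + edgeCount G
    ≡⟨ cong₂ _+_ count (trans count (∑-swap (λ u v → 𝟙 (upper u v)) V V)) ⟩
  ∑ (λ u → ∑ (λ v → 𝟙 (upper u v)) V) V + ∑ (λ u → ∑ (λ v → 𝟙 (upper v u)) V) V
    ≡⟨ ∑-distrib-+ (λ u → ∑ (λ v → 𝟙 (upper u v)) V) (λ u → ∑ (λ v → 𝟙 (upper v u)) V) V ⟨
  ∑ (λ u → ∑ (λ v → 𝟙 (upper u v)) V + ∑ (λ v → 𝟙 (upper v u)) V) V
    ≡⟨ ∑-cong (λ u → trans (sym (∑-distrib-+ (λ v → 𝟙 (upper u v)) (λ v → 𝟙 (upper v u)) V))
                           (∑-cong (either u) V)) V ⟩
  ∑ (degIn G V) V ∎
  where
  open Relation.Binary.PropositionalEquality.≡-Reasoning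
  V = allFin n
  upper : Fin n → Fin n → Bool
  upper u v = (toℕ u <ᵇ toℕ v) ∧ adj G u v
  count : edgeCount G ≡ ∑ (λ u → # (upper u) V) V
  count = trans (length-concatMap _ V) (∑-cong (λ u → length-filter-≟ (upper u) V) V)
  either : ∀ u v → 𝟙 (upper u v) + 𝟙 (upper v u) ≡ 𝟙 (adj G u v)
  either u v with <-cmp (toℕ u) (toℕ v)
  ... | tri< lt _ _ rewrite <ᵇ-true lt | <ᵇ-false (<⇒≤ lt) = +-identityʳ _
  ... | tri> _ _ gt rewrite <ᵇ-true gt | <ᵇ-false (<⇒≤ gt) = cong 𝟙 (adj-sym G v u)
  ... | tri≈ _ eq _ with toℕ-injective eq
  ...   | refl rewrite <ᵇ-false (≤-refl {toℕ u}) = cong 𝟙 (sym (adj-irrefl G u))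

-- C(m, 2) = m(m - 1)/2 without subtraction or division.
choose-2 : ∀ m → m C 2 + m C 2 + m ≡ m * m
choose-2 zero    = refl
choose-2 (suc m) = begin
  suc m C 2 + suc m C 2 + suc m                      ≡⟨ cong (λ i → i + i + suc m) pascal ⟩
  (m + m C 2) + (m + m C 2) + suc m                  ≡⟨ rearrange m (m C 2) ⟩
  m C 2 + m C 2 + m + suc (m + m)                    ≡⟨ cong (_+ suc (m + m)) (choose-2 m) ⟩
  m * m + suc (m + m)                                ≡⟨ square m ⟩
  suc m * suc m                                      ∎
  where
  open Relation.Binary.PropositionalEquality.≡-Reasoning
  pascal : suc m C 2 ≡ m + m C 2
  pascal = trans (sym (nCk+nC[k+1]≡[n+1]C[k+1] m 1)) (cong (_+ m C 2) (nC1≡n m))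
  rearrange : ∀ m c → (m + c) + (m + c) + suc m ≡ c + c + m + suc (m + m)
  rearrange = solve-∀
  square : ∀ m → m * m + suc (m + m) ≡ suc m * suc m
  square = solve-∀

-- The two edge counts: w = n - k, c = C(n - k, 2), e is the number of edges, and
-- t and s are the numbers of vertices of degree > n/2 and ≤ n/2.
few-high-degrees : ∀ {k w c e t s} → 1 ≤ k → 10 * k ≤ w → c + c + w ≡ w * w →
  c + k * (k + 1) < e → t + s ≡ w + k → t + t ≤ w + k →
  (e + e) + (e + e) ≤ (t * (w + k) + t * (w + k)) + s * (w + k) → ⊥
few-high-degrees {suc j} {w} {c} {e} {t} {s} _ 10k≤w c-eq big t+s 2t≤N bound
  with m≤n⇒∃[o]m+o≡n 10k≤w
... | r , refl = <-irrefl refl (begin-strict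
  4 * (w * w) + 8 * (k * (k + 1)) + 8                 ≡⟨ cong (λ i → 4 * i + 8 * (k * (k + 1)) + 8) c-eq ⟨
  4 * (c + c + w) + 8 * (k * (k + 1)) + 8             ≡⟨ step₁ c (k * (k + 1)) w ⟩
  8 * suc (c + k * (k + 1)) + 4 * w                   ≤⟨ +-monoˡ-≤ (4 * w) (*-monoʳ-≤ 8 big) ⟩
  8 * e + 4 * w                                       ≡⟨ step₂ e w ⟩
  2 * ((e + e) + (e + e)) + 4 * w                     ≤⟨ +-monoˡ-≤ (4 * w) (*-monoʳ-≤ 2 bound) ⟩
  2 * ((t * N + t * N) + s * N) + 4 * w               ≡⟨ step₃ t s N w ⟩
  (t + t) * N + 2 * ((t + s) * N) + 4 * w             ≡⟨ cong (λ i → (t + t) * N + 2 * (i * N) + 4 * w) t+s ⟩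
  (t + t) * N + 2 * (N * N) + 4 * w                   ≤⟨ +-monoˡ-≤ (4 * w) (+-monoˡ-≤ (2 * (N * N)) (*-monoˡ-≤ N 2t≤N)) ⟩
  -- Here `10 * k ≤ w` pays off: with one factor of `w * w` written as `10 * k + r` and `k` as
  -- `suc j`, subtracting `6 * w * k + 4 * w` leaves `4 * (w * j) + w * r`, so the slack has only
  -- nonnegative terms.
  N * N + 2 * (N * N) + 4 * w                         <⟨ s≤s (m≤m+n _ (4 * (w * j) + w * r + 5 * (k * k) + 8 * k + 7)) ⟩
  suc (N * N + 2 * (N * N) + 4 * w + (4 * (w * j) + w * r + 5 * (k * k) + 8 * k + 7))  ≡⟨ step₄ j r ⟩
  4 * (w * w) + 8 * (k * (k + 1)) + 8                 ∎)
  where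
  open ≤-Reasoning
  k N : ℕ
  k = suc j
  N = w + k
  step₁ : ∀ c l w → 4 * (c + c + w) + 8 * l + 8 ≡ 8 * suc (c + l) + 4 * w
  step₁ = solve-∀
  step₂ : ∀ e w → 8 * e + 4 * w ≡ 2 * ((e + e) + (e + e)) + 4 * w
  step₂ = solve-∀
  step₃ : ∀ t s N w → 2 * ((t * N + t * N) + s * N) + 4 * w ≡ (t + t) * N + 2 * ((t + s) * N) + 4 * w
  step₃ = solve-∀
  step₄ : ∀ j r → let k = suc j ; w = 10 * k + r ; N = w + k in
    suc (N * N + 2 * (N * N) + 4 * w + (4 * (w * j) + w * r + 5 * (k * k) + 8 * k + 7)) ≡
    4 * (w * w) + 8 * (k * (k + 1)) + 8
  step₄ = solve-∀

few-low-degrees : ∀ {k j c e t s w} → k + j ≡ s → t + j ≡ w →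
  c + c + w ≡ w * w → c + k * (k + 1) < e → s < t → 3 * k + 2 ≤ t →
  e + e + t ≤ t * t + (s * suc s + s * suc s) → ⊥
few-low-degrees {k} {j} {c} {e} {t} refl refl c-eq big s<t 3k+2≤t bound = <-irrefl refl (begin-strict
  t * t + (s * suc s + s * suc s) + j                               <⟨ m<m+n _ {2} (s≤s z≤n) ⟩
  -- With `s = k + j`, twice `s * suc s` exceeds twice `k * (k + 1)` by `2 * j * (2 * k + j + 1)`.
  -- The grouping isolates two factors, `suc s` and `3 * k + 2`, each at most `t`, to reach the
  -- cross term of the square of `t + j`.
  t * t + (s * suc s + s * suc s) + j + 2                           ≡⟨ step₁ k j t ⟩
  t * t + j * j + j * (suc s + (3 * k + 2)) + 2 * (k * (k + 1)) + 2 ≤⟨ +-monoˡ-≤ 2 (+-monoˡ-≤ (2 * (k * (k + 1)))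
                                                                         (+-monoʳ-≤ (t * t + j * j) (*-monoʳ-≤ j (+-mono-≤ s<t 3k+2≤t)))) ⟩
  t * t + j * j + j * (t + t) + 2 * (k * (k + 1)) + 2               ≡⟨ step₂ k j t ⟩
  w * w + 2 * (k * (k + 1)) + 2                                     ≡⟨ cong (λ i → i + 2 * (k * (k + 1)) + 2) c-eq ⟨
  c + c + w + 2 * (k * (k + 1)) + 2                                 ≡⟨ step₃ c (k * (k + 1)) w ⟩
  suc (c + k * (k + 1)) + suc (c + k * (k + 1)) + w                 ≤⟨ +-monoˡ-≤ w (+-mono-≤ big big) ⟩
  e + e + (t + j)                                                   ≡⟨ +-assoc (e + e) t j ⟨
  e + e + t + j                                                     ≤⟨ +-monoˡ-≤ j bound ⟩
  t * t + (s * suc s + s * suc s) + j                               ∎)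
  where
  open ≤-Reasoning
  s w : ℕ
  s = k + j
  w = t + j
  step₁ : ∀ k j t → let s = k + j in t * t + (s * suc s + s * suc s) + j + 2 ≡
    t * t + j * j + j * (suc s + (3 * k + 2)) + 2 * (k * (k + 1)) + 2
  step₁ = solve-∀
  step₂ : ∀ k j t → let w = t + j in t * t + j * j + j * (t + t) + 2 * (k * (k + 1)) + 2 ≡
    w * w + 2 * (k * (k + 1)) + 2
  step₂ = solve-∀
  step₃ : ∀ c l w → c + c + w + 2 * l + 2 ≡ suc (c + l) + suc (c + l) + w
  step₃ = solve-∀

-- The structure of a closed graph with many edges.

nonempty : {zs : List X} → 0 < length zs → ∃ (_∈ zs)
nonempty {zs = z ∷ _} _ = z , here refl

-- What the closure retains of the hypotheses on the original graph.
record Dense {n} (G : Graph n) (k : ℕ) : Set where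
  V : List (Fin n)
  V = allFin n
  field
    2≤k        : 2 ≤ k
    11k≤n      : 11 * k ≤ n
    closed     : Closed G V
    min-degree : ∀ u → k ≤ degIn G V u
    -- The edge count of the graph that was closed up to G.
    edges      : ℕ
    many-edges : ((n ∸ k) C 2) + k * (k + 1) < edges
    degree-sum : edges + edges ≤ ∑ (degIn G V) V

  1≤k : 1 ≤ k
  1≤k = <⇒≤ 2≤k

  k≤n : k ≤ n
  k≤n = ≤-trans (m≤m+n k (10 * k)) 11k≤n

  length-V : length V ≡ n
  length-V = length-tabulate (λ u → u)

  w : ℕ
  w = n ∸ k

  w+k≡n : w + k ≡ n
  w+k≡n = m∸n+n≡m k≤n

  10k≤w : 10 * k ≤ w
  10k≤w = ≤-trans (≤-reflexive (sym (m+n∸m≡n k (10 * k)))) (∸-monoˡ-≤ k 11k≤n)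

  d : Fin n → ℕ
  d = degIn G V

  High : Fin n → Set
  High u = n < d u + d u

  high? : Decidable High
  high? u = n <? d u + d u

  K F : List (Fin n)
  K = filter high? V
  F = filter (∁? high?) V

  t = length K
  s = length F

  V↭ : V ↭ K ++ F
  V↭ = filter-↭-∁ high? V

  t+s≡n : t + s ≡ n
  t+s≡n = trans (sym (length-++ K)) (trans (sym (↭-length V↭)) length-V)

  high : ∀ {u} → u ∈ K → High u
  high u∈ = proj₂ (∈-filter⁻ high? {xs = V} u∈)

  low : ∀ {u} → u ∈ F → ¬ High u
  low u∈ = proj₂ (∈-filter⁻ (∁? high?) {xs = V} u∈)

  uniqueK : Unique K
  uniqueK = filter⁺ high? (allFin⁺ n)

  cliqueK : Clique G K
  cliqueK {u} {v} u∈ v∈ u≢v = ¬-not λ nonadj → <-irrefl refl (begin-strict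
    n + n                     <⟨ +-mono-< (high u∈) (high v∈) ⟩
    d u + d u + (d v + d v)   ≡⟨ interchange (d u) (d v) ⟩
    d u + d v + (d u + d v)   ≤⟨ +-mono-≤ (closed u≢v nonadj) (closed u≢v nonadj) ⟩
    length V + length V       ≡⟨ cong (λ i → i + i) length-V ⟩
    n + n                     ∎)
    where
    open ≤-Reasoning
    interchange : ∀ a b → a + a + (b + b) ≡ a + b + (a + b)
    interchange = solve-∀

  dK dF : Fin n → ℕ
  dK = degIn G K
  dF = degIn G F

  d-split : ∀ u → d u ≡ dK u + dF u
  d-split u = trans (∑-↭ _ V↭) (∑-++ _ K F)

  sum-split : ∀ (g : Fin n → ℕ) → ∑ g V ≡ ∑ g K + ∑ g F
  sum-split g = trans (∑-↭ g V↭) (∑-++ g K F)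

  t≤1+dK : ∀ {u} → u ∈ K → t ≤ suc (dK u)
  t≤1+dK {u} u∈ = #-all-but u uniqueK λ v∈ v≢u → cliqueK u∈ v∈ (≢-sym v≢u)

  d≤n : ∀ u → d u ≤ n
  d≤n u = ≤-trans (#-≤-length _ V) (≤-reflexive length-V)

  -- High vertices have degree at most `n` and the others at most n/2. If at most half the vertices
  -- were high, the degree sum would be too small; doubling it avoids halves.
  2t>n : n < t + t
  2t>n = ≰⇒> λ 2t≤n → few-high-degrees {t = t} {s} 1≤k 10k≤w (choose-2 w) many-edges
    (trans t+s≡n (sym w+k≡n)) (≤-trans 2t≤n (≤-reflexive (sym w+k≡n)))
    (subst (λ m → edges + edges + (edges + edges) ≤ t * m + t * m + s * m) (sym w+k≡n) bound)
    where
    open ≤-Reasoning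
    interchange : ∀ a b → a + b + (a + b) ≡ a + a + (b + b)
    interchange = solve-∀
    bound : edges + edges + (edges + edges) ≤ t * n + t * n + s * n
    bound = begin
      edges + edges + (edges + edges)            ≤⟨ +-mono-≤ degree-sum degree-sum ⟩
      ∑ d V + ∑ d V                              ≡⟨ cong (λ i → i + i) (sum-split d) ⟩
      ∑ d K + ∑ d F + (∑ d K + ∑ d F)            ≡⟨ interchange (∑ d K) (∑ d F) ⟩
      ∑ d K + ∑ d K + (∑ d F + ∑ d F)            ≡⟨ cong (∑ d K + ∑ d K +_) (∑-distrib-+ d d F) ⟨
      ∑ d K + ∑ d K + ∑ (λ u → d u + d u) F      ≤⟨ +-mono-≤ (+-mono-≤ ∑dK ∑dK) (∑-bound n F (λ u∈ → ≮⇒≥ (low u∈))) ⟩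
      t * n + t * n + s * n                      ∎
      where
      ∑dK : ∑ d K ≤ t * n
      ∑dK = ∑-bound n K (λ {u} _ → d≤n u)

  -- A vertex adjacent to all of `K` has degree at least `t`, more than n/2, and would be high
  -- itself.
  non-neighbour : ∀ {v} → v ∈ F → ∃ λ c → c ∈ K × adj G v c ≡ false
  non-neighbour {v} v∈ with Any.any? (λ c → adj G v c ≟ᵇ false) K
  ... | yes some = find some
  ... | no none  = contradiction (≤-trans 2t>n (+-mono-≤ t≤d t≤d)) (low v∈)
    where
    t≤d : t ≤ d v
    t≤d = begin
      t              ≡⟨ #-all K (λ c∈ → ¬-not λ nonadj → none (lose c∈ nonadj)) ⟨
      dK v           ≤⟨ m≤m+n _ _ ⟩
      dK v + dF v    ≡⟨ d-split v ⟨
      d v            ∎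
      where open ≤-Reasoning

  nonadjacent-sum : ∀ {c v} → c ∈ K → v ∈ F → adj G c v ≡ false → d c + d v ≤ n
  nonadjacent-sum c∈ v∈ nonadj =
    ≤-trans (closed (λ { refl → low v∈ (high c∈) }) nonadj) (≤-reflexive length-V)

  -- A non-neighbour of `v` in `K` has degree at least `t - 1`, while the two degrees sum to at most
  -- `n = t + s`.
  d≤1+s : ∀ {v} → v ∈ F → d v ≤ suc s
  d≤1+s {v} v∈ with non-neighbour v∈
  ... | c , c∈ , nonadj = +-cancelˡ-≤ t _ _ (begin
    t + d v              ≤⟨ +-monoˡ-≤ (d v) (t≤1+dK c∈) ⟩
    suc (dK c) + d v     ≤⟨ s≤s (+-monoˡ-≤ (d v) (≤-trans (m≤m+n _ _) (≤-reflexive (sym (d-split c))))) ⟩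
    suc (d c + d v)      ≤⟨ s≤s (nonadjacent-sum c∈ v∈ (trans (adj-sym G c v) nonadj)) ⟩
    suc n                ≡⟨ cong suc t+s≡n ⟨
    suc (t + s)          ≡⟨ +-suc t s ⟨
    t + suc s            ∎)
    where open ≤-Reasoning

  -- Pairs inside `K` contribute at most `t * (t - 1)`. The edges between `K` and `F`, seen from
  -- `K`, are at most the degree sum of `F`, so that sum is charged twice.
  degree-sum-bound : ∑ d V + t ≤ t * t + (s * suc s + s * suc s)
  degree-sum-bound = begin
    ∑ d V + t                             ≡⟨ cong (_+ t) (sum-split d) ⟩
    ∑ d K + ∑ d F + t                     ≡⟨ cong (λ i → i + ∑ d F + t) (trans (∑-cong d-split K) (∑-distrib-+ dK dF K)) ⟩
    ∑ dK K + ∑ dF K + ∑ d F + t           ≡⟨ rearrange (∑ dK K) (∑ dF K) (∑ d F) t ⟩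
    (t + ∑ dK K) + (∑ dF K + ∑ d F)       ≤⟨ +-mono-≤ inside (+-mono-≤ (≤-trans across ∑dF) ∑dF) ⟩
    t * t + (s * suc s + s * suc s)       ∎
    where
    open ≤-Reasoning
    rearrange : ∀ a b c t → a + b + c + t ≡ (t + a) + (b + c)
    rearrange = solve-∀
    ∑dF : ∑ d F ≤ s * suc s
    ∑dF = ∑-bound (suc s) F d≤1+s
    inside : t + ∑ dK K ≤ t * t
    inside = begin
      t + ∑ dK K                   ≡⟨ cong (_+ ∑ dK K) (trans (∑-const 1 K) (*-identityʳ t)) ⟨
      ∑ (λ _ → 1) K + ∑ dK K       ≡⟨ ∑-distrib-+ (λ _ → 1) dK K ⟨
      ∑ (λ u → suc (dK u)) K       ≤⟨ ∑-bound t K (λ {u} u∈ → #-miss K u∈ (adj-irrefl G u)) ⟩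
      t * t                        ∎
    across : ∑ dF K ≤ ∑ d F
    across = begin
      ∑ dF K                                  ≡⟨ ∑-swap (λ c v → 𝟙 (adj G c v)) K F ⟩
      ∑ (λ v → ∑ (λ c → 𝟙 (adj G c v)) K) F   ≡⟨ ∑-cong (λ v → ∑-cong (λ c → cong 𝟙 (adj-sym G c v)) K) F ⟩
      ∑ dK F                                  ≤⟨ ∑-mono F (λ {v} _ → ≤-trans (m≤m+n _ (dF v)) (≤-reflexive (sym (d-split v)))) ⟩
      ∑ d F                                   ∎

  s<k : s < k
  s<k = ≰⇒> λ k≤s → impossible (m≤n⇒∃[o]m+o≡n k≤s)
    where
    s<t : s < t
    s<t = +-cancelˡ-< t _ _ (≤-trans (s≤s (≤-reflexive t+s≡n)) 2t>n)
    3k+2≤t : 3 * k + 2 ≤ t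
    3k+2≤t = ≮⇒≥ λ t<3k+2 → <-irrefl refl (begin-strict
      -- Doubling `3 * k + 1` gives `6 * k + 2`, which stays below `11 * k` because `2 ≤ 5 * k`.
      n                        <⟨ 2t>n ⟩
      t + t                    ≤⟨ +-mono-≤ (t≤ t<3k+2) (t≤ t<3k+2) ⟩
      3 * k + 1 + (3 * k + 1)  ≡⟨ step₁ k ⟩
      6 * k + 2 * 1            ≤⟨ +-monoʳ-≤ (6 * k) (*-mono-≤ {2} {5} (s≤s (s≤s z≤n)) 1≤k) ⟩
      6 * k + 5 * k            ≡⟨ step₂ k ⟩
      11 * k                   ≤⟨ 11k≤n ⟩
      n                        ∎)
      where
      open ≤-Reasoning
      t≤ : t < 3 * k + 2 → t ≤ 3 * k + 1
      t≤ lt = ≤-pred (≤-trans lt (≤-reflexive (+-suc (3 * k) 1)))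
      step₁ : ∀ k → 3 * k + 1 + (3 * k + 1) ≡ 6 * k + 2 * 1
      step₁ = solve-∀
      step₂ : ∀ k → 6 * k + 5 * k ≡ 11 * k
      step₂ = solve-∀
    impossible : ∃ (λ j → k + j ≡ s) → ⊥
    impossible (j , k+j≡s) = few-low-degrees {j = j} k+j≡s t+j≡w (choose-2 w) many-edges s<t 3k+2≤t
      (≤-trans (+-monoˡ-≤ t degree-sum) degree-sum-bound)
      where
      t+j≡w : t + j ≡ w
      t+j≡w = +-cancelʳ-≡ k _ _ (begin
        t + j + k      ≡⟨ +-assoc t j k ⟩
        t + (j + k)    ≡⟨ cong (t +_) (trans (+-comm j k) k+j≡s) ⟩
        t + s          ≡⟨ t+s≡n ⟩
        n              ≡⟨ w+k≡n ⟨
        w + k          ∎)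
        where open Relation.Binary.PropositionalEquality.≡-Reasoning

  -- One neighbour in `F` lifts the degree of `c` to at least `t`. Added to a degree of at least
  -- `k > s`, this exceeds `n`, so closedness joins `c` to every vertex of `F`. All of `F` thus has
  -- one common neighbourhood in `K`.
  neighbour-of-F : ∀ {c v v′} → c ∈ K → v ∈ F → v′ ∈ F → adj G c v ≡ true → adj G c v′ ≡ true
  neighbour-of-F {c} {v} {v′} c∈ v∈ v′∈ e = ¬-not λ nonadj → <-irrefl refl (begin-strict
    t + s               <⟨ +-monoʳ-< t s<k ⟩
    t + k               ≤⟨ +-mono-≤ t≤dc (min-degree v′) ⟩
    d c + d v′          ≤⟨ nonadjacent-sum c∈ v′∈ nonadj ⟩
    n                   ≡⟨ t+s≡n ⟨
    t + s               ∎)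
    where
    open ≤-Reasoning
    t≤dc : t ≤ d c
    t≤dc = begin
      t              ≤⟨ t≤1+dK c∈ ⟩
      suc (dK c)     ≡⟨ +-comm 1 (dK c) ⟩
      dK c + 1       ≤⟨ +-monoʳ-≤ (dK c) (#-pos F v∈ e) ⟩
      dK c + dF c    ≡⟨ d-split c ⟨
      d c            ∎

  complete-if-F-empty : (∀ {v} → v ∉ F) → Clique G V
  complete-if-F-empty none {x} {y} x∈ y∈ = cliqueK (inK x) (inK y)
    where
    inK : ∀ u → u ∈ K
    inK u with ∈-++⁻ K (∈-resp-↭ V↭ (∈-allFin u))
    ... | inj₁ u∈K = u∈K
    ... | inj₂ u∈F = contradiction u∈F none

  module _ {v₀} (v₀∈F : v₀ ∈ F) where

    joined? : Decidable (λ c → adj G v₀ c ≡ true)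
    joined? c = adj G v₀ c ≟ᵇ true

    A B : List (Fin n)
    A = filter joined? K
    B = filter (∁? joined?) K

    K↭ : K ↭ A ++ B
    K↭ = filter-↭-∁ joined? K

    -- The chain from `k` through the degree of `v₀` and `suc s` back to `k` collapses; the same
    -- squeeze gives every vertex of `F` degree `k` in `split`.
    1+s≡k : suc s ≡ k
    1+s≡k = ≤-antisym s<k (≤-trans (min-degree v₀) (d≤1+s v₀∈F))

    split : Split G k A B F
    split = record
      { cover  = ↭-trans V↭ (++⁺ʳ F K↭)
      ; clique = λ x∈ y∈ → cliqueK (∈-resp-↭ (↭-sym K↭) x∈) (∈-resp-↭ (↭-sym K↭) y∈)
      ; full   = full
      ; empty  = empty
      ; degF   = λ {v} v∈ → ≤-antisym (≤-trans (d≤1+s v∈) (≤-reflexive 1+s≡k)) (min-degree v)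
      ; sizeF  = 1+s≡k
      }
      where
      full : ∀ {c v} → c ∈ A → v ∈ F → adj G c v ≡ true
      full c∈A v∈F with ∈-filter⁻ joined? {xs = K} c∈A
      ... | c∈K , e = neighbour-of-F c∈K v₀∈F v∈F (adj-flip G e)
      empty : ∀ {c v} → c ∈ B → v ∈ F → adj G c v ≡ false
      empty c∈B v∈F with ∈-filter⁻ (∁? joined?) {xs = K} c∈B
      ... | c∈K , ¬e = ¬-not λ e → ¬e (adj-flip G (neighbour-of-F c∈K v∈F v₀∈F e))

    open Split split using (degree-split)

    k≡a+dF : length A + dF v₀ ≡ k
    k≡a+dF = trans (cong (_+ dF v₀) (sym (#-all A λ {c} c∈A → proj₂ (∈-filter⁻ joined? {xs = K} c∈A))))
      (degree-split v₀∈F)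

    a≤k : length A ≤ k
    a≤k = ≤-trans (m≤m+n _ _) (≤-reflexive k≡a+dF)

    -- The vertex `v₀` is not its own neighbour, so at most `k - 2` of its `k` neighbours lie in
    -- `F`.
    2≤a : 2 ≤ length A
    2≤a = +-cancelʳ-≤ (dF v₀) _ _ (begin
      2 + dF v₀             ≤⟨ s≤s (#-miss F v₀∈F (adj-irrefl G v₀)) ⟩
      suc s                 ≡⟨ 1+s≡k ⟩
      k                     ≡⟨ k≡a+dF ⟨
      length A + dF v₀      ∎)
      where open ≤-Reasoning

    -- `A` and `F` together have fewer than `2 * k` vertices.
    0<b : 0 < length B
    0<b = n≢0⇒n>0 λ b≡0 → <-irrefl refl (begin-strict
      n                            ≡⟨ t+s≡n ⟨
      t + s                        ≡⟨ cong (_+ s) (trans (↭-length K↭) (length-++ A)) ⟩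
      length A + length B + s      ≡⟨ cong (λ i → length A + i + s) b≡0 ⟩
      length A + 0 + s             ≡⟨ cong (_+ s) (+-identityʳ (length A)) ⟩
      length A + s                 <⟨ +-mono-≤-< a≤k s<k ⟩
      k + k                        ≤⟨ +-monoʳ-≤ k (m≤m+n k (9 * k)) ⟩
      11 * k                       ≤⟨ 11k≤n ⟩
      n                            ∎)
      where open ≤-Reasoning

    outcome : HConnectedOn G V ⊎ IsoToSubgraphOf G (S n k) ⊎ IsoToSubgraphOf G (T n k)
    outcome with <-cmp (length A) k | <-cmp 2 (length A)
    ... | tri> _ _ k<a | _             = contradiction k<a (≤⇒≯ a≤k)
    -- When `k = 2` both extremal cases apply, and this one is taken.
    ... | tri≈ _ a≡k _ | _             = inj₂ (inj₁ (Embedding.⊆-S k≤n split a≡k))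
    ... | _            | tri≈ _ 2≡a _  = inj₂ (inj₂ (Embedding.⊆-T k≤n split (sym 2≡a)))
    ... | _            | tri> _ _ a<2  = contradiction a<2 (≤⇒≯ 2≤a)
    ... | tri< a<k _ _ | tri< 3≤a _ _  =
      inj₁ (Split.middle-HConnected split 3≤a a<k (proj₂ (nonempty (<-trans z<s 2≤a))) (proj₂ (nonempty 0<b)))

  HConnected-or-extremal : HConnectedOn G V ⊎ IsoToSubgraphOf G (S n k) ⊎ IsoToSubgraphOf G (T n k)
  HConnected-or-extremal with F in eq
  ... | []    = inj₁ (clique-HConnected (allFin⁺ n) (complete-if-F-empty λ v∈ → contradiction (subst (_ ∈_) eq v∈) λ ()))
  ... | v ∷ _ = outcome (subst (v ∈_) (sym eq) (here refl))

-- Passing from the closure back to the original graph.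

theorem3p1 : (k n : ℕ) → 2 ≤ k → 11 * k ≤ n → (G : Graph n) →
    MinDegreeAtLeast G k →
    ((n ∸ k) C 2) + k * (k + 1) < edgeCount G →
    HamiltonConnected G ⊎ (IsoToSubgraphOf G (S n k) ⊎ IsoToSubgraphOf G (T n k))
theorem3p1 k n 2≤k 11k≤n G δ≥k many with closure G (allFin⁺ n)
... | H , G⊑H , closed , transfer with Dense.HConnected-or-extremal record
  { 2≤k        = 2≤k
  ; 11k≤n      = 11k≤n
  ; closed     = closed
  ; min-degree = λ u → ≤-trans (δ≥k u) (≤-trans (≤-reflexive (degree-degIn G u)) (#-mono (allFin n) (G⊑H u)))
  ; edges      = edgeCount G
  ; many-edges = many
  ; degree-sum = ≤-trans (≤-reflexive (handshake G)) (∑-mono (allFin n) λ {u} _ → #-mono (allFin n) (G⊑H u))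
  }
-- `G` is a spanning subgraph of its closure `H`, so an embedding of `H` is also one of `G`.
...   | inj₂ (inj₁ (f , inj , hom)) = inj₂ (inj₁ (f , inj , λ u v e → hom u v (G⊑H u v e)))
...   | inj₂ (inj₂ (f , inj , hom)) = inj₂ (inj₂ (f , inj , λ u v e → hom u v (G⊑H u v e)))
...   | inj₁ hc = inj₁ λ u v u≢v → hamilton (transfer hc (∈-allFin u) (∈-allFin v) u≢v)
  where
  hamilton : ∀ {u v} → (∃ λ ps → Walk G u v ps × ps ↭ allFin n) → HamiltonPath G u v
  hamilton (ps , p , ps↭) =
    ps , p , Unique-resp-↭ (↭-sym ps↭) (allFin⁺ n) , λ x → ∈-resp-↭ (↭-sym ps↭) (∈-allFin x)
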